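{- There exist absolute constants $0<a\leq b$ such that for every integer $n\geq 2$ there exists a normal graph $G$ on $n$ vertices with $a\log_2 n\leq \omega(G)\leq b\log_2 n$ and $a\log_2 n\leq \alpha(G)\leq b\log_2 n$; that is, for all $n$ there is a normal graph with $n$ vertices whose clique number and independence number are both of order $\Theta(\log n)$.
   Context: A graph $G$ is normal if it admits a set $\mathcal C$ of cliques covering all vertices and a set $\mathcal S$ of stable sets covering all vertices such that every clique in $\mathcal C$ and every stable set in $\mathcal S$ have a vertex in common. $\omega(G)$ is the clique number and $\alpha(G)$ the independence number. -}

module Defs where

open import Data.Nat using (ℕ; _≤_)
open import Data.Fin using (Fin)
open import Data.Bool using (Bool; true; false)
open import Data.Fin.Subset using (Subset; _∈_; ∣_∣)
open import Data.List using (List)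
import Data.List.Membership.Propositional as LM
open import Data.Product using (Σ; _×_; ∃; ∃-syntax)
open import Relation.Binary.PropositionalEquality using (_≡_; _≢_)

record Graph (n : ℕ) : Set where
  field
    adj    : Fin n → Fin n → Bool
    symm   : ∀ u v → adj u v ≡ adj v u
    irrefl : ∀ v → adj v v ≡ false
open Graph public

module _ {n : ℕ} (G : Graph n) where

  IsClique : Subset n → Set
  IsClique C = ∀ u v → u ∈ C → v ∈ C → u ≢ v → adj G u v ≡ true

  IsStable : Subset n → Set
  IsStable S = ∀ u v → u ∈ S → v ∈ S → adj G u v ≡ false

  IsCliqueNumber : ℕ → Set
  IsCliqueNumber k =
    (Σ (Subset n) λ C → IsClique C × ∣ C ∣ ≡ k) × (∀ C → IsClique C → ∣ C ∣ ≤ k)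

  IsIndependenceNumber : ℕ → Set
  IsIndependenceNumber k =
    (Σ (Subset n) λ S → IsStable S × ∣ S ∣ ≡ k) × (∀ S → IsStable S → ∣ S ∣ ≤ k)

  Covers : List (Subset n) → Set
  Covers 𝒳 = ∀ v → ∃[ X ] (X LM.∈ 𝒳 × v ∈ X)

  IsNormal : Set
  IsNormal = Σ (List (Subset n)) λ 𝒞 → Σ (List (Subset n)) λ 𝒮 →
      (∀ C → C LM.∈ 𝒞 → IsClique C)
    × (∀ S → S LM.∈ 𝒮 → IsStable S)
    × Covers 𝒞 × Covers 𝒮
    × (∀ C S → C LM.∈ 𝒞 → S LM.∈ 𝒮 → ∃[ v ] (v ∈ C × v ∈ S))

{-# OPTIONS --safe #-}
module Submission where

-- Let V₁ and V₂ carry normal graphs, and add two vertices: x, complete to V₁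
-- and anticomplete to V₂, and y, complete to V₂ and anticomplete to V₁.
-- Adding x to the cliques of V₁ and to the stable sets of V₂, and y to the
-- cliques of V₂ and to the stable sets of V₁, shows that the result is normal
-- however V₁ and V₂ are joined to each other. Iterating this along a balanced
-- binary tree of depth about log n prescribes only O(|T| log n) of the pairs
-- inside a vertex set T, while it creates a clique and a stable set of size
-- proportional to log n. Hence a set T of size 14 ⌈log n⌉ still contains so many
-- open pairs that Erdős's union bound yields a choice of them for which no such T
-- is a clique or stable.

open import Defs
open import Data.Bool using (Bool; true; false)
import Data.Bool.Properties as Bool
open import Data.Fin using (Fin; zero; suc; _↑ˡ_; _↑ʳ_)
import Data.Fin.Properties as Fin
open import Data.Fin.Subset using (Subset; _∈_; _∉_; _⊆_; ∣_∣; ⁅_⁆; ⊥; ⊤; _∪_)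
open import Data.Fin.Subset.Properties
open import Data.List using (List; []; _∷_; _++_; map; length; allFin)
open import Data.List.Properties using (length-map; length-++)
import Data.List.Membership.Propositional as List
open import Data.List.Membership.Propositional.Properties using (∈-++⁺ˡ; ∈-++⁺ʳ; ∈-++⁻; ∈-map⁺; ∈-map⁻; ∈-allFin)
open import Data.List.Relation.Unary.All using (All; []; _∷_)
import Data.List.Relation.Unary.All as All
open import Data.List.Relation.Unary.Any using (here; there)
open import Data.Maybe using (Maybe; just; nothing; fromMaybe)
open import Data.Nat using (ℕ; zero; suc; _+_; _*_; _^_; _≤_; _<_; z≤n; s≤s; ⌊_/2⌋; ⌈_/2⌉)
open import Data.Nat.ListAction using (sum)
open import Data.Nat.Properties
open import Data.Nat.Tactic.RingSolver using (solve-∀)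
open import Data.Product using (Σ; _×_; ∃-syntax; _,_; proj₁; proj₂)
open import Data.Sum using (_⊎_; inj₁; inj₂)
import Data.Vec as Vec
open Vec using (Vec; []; _∷_; here; there; lookup; replicate)
open import Data.Vec.Properties using (lookup-++ˡ; lookup-++ʳ; lookup-replicate; lookup-zipWith)
open import Function using (_∘_; case_of_)
open import Relation.Binary.PropositionalEquality
open import Relation.Nullary using (¬_; Dec; yes; no; contradiction)
open import Relation.Nullary.Decidable using (_→-dec_; _×-dec_; ¬?)

private variable
  A : Set
  m n : ℕ

-- Clauses forbidding partial assignments

Clause : ℕ → Set
Clause = Vec (Maybe Bool)

-- A clause encodes a bad event as a subcube of the assignments, with `nothing` at the free
-- coordinates.
data Hits : Clause n → Vec Bool n → Set where
  []   : Hits [] []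
  free : ∀ {c : Clause n} {x b} → Hits c x → Hits (nothing ∷ c) (b ∷ x)
  bind : ∀ {c : Clause n} {x b} → Hits c x → Hits (just b ∷ c) (b ∷ x)

-- The number of assignments hit by the clause.
weight : Clause n → ℕ
weight []            = 1
weight (nothing ∷ c) = 2 * weight c
weight (just _ ∷ c)  = weight c

width : Clause n → ℕ
width []            = 0
width (nothing ∷ c) = width c
width (just _ ∷ c)  = suc (width c)

totalWeight : List (Clause n) → ℕ
totalWeight = sum ∘ map weight

restrict : Bool → List (Clause (suc n)) → List (Clause n)
restrict b     []                       = []
restrict b     ((nothing ∷ c) ∷ cs)     = c ∷ restrict b cs
restrict true  ((just true ∷ c) ∷ cs)   = c ∷ restrict true cs
restrict true  ((just false ∷ c) ∷ cs)  = restrict true cs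
restrict false ((just true ∷ c) ∷ cs)   = restrict false cs
restrict false ((just false ∷ c) ∷ cs)  = c ∷ restrict false cs

-- The assignments hit by a clause split by their first value: a free first coordinate leaves the
-- same count on both sides, a bound one puts everything on a single side.
totalWeight-restrict : (cs : List (Clause (suc n))) →
  totalWeight (restrict true cs) + totalWeight (restrict false cs) ≡ totalWeight cs
totalWeight-restrict [] = refl
totalWeight-restrict ((nothing ∷ c) ∷ cs) rewrite sym (totalWeight-restrict cs) =
  double (weight c) (totalWeight (restrict true cs)) (totalWeight (restrict false cs))
  where
  double : ∀ w s t → (w + s) + (w + t) ≡ 2 * w + (s + t)
  double = solve-∀
totalWeight-restrict ((just true ∷ c) ∷ cs) rewrite sym (totalWeight-restrict cs) =
  +-assoc (weight c) _ _
totalWeight-restrict ((just false ∷ c) ∷ cs) rewrite sym (totalWeight-restrict cs) =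
  swap (weight c) (totalWeight (restrict true cs)) (totalWeight (restrict false cs))
  where
  swap : ∀ w s t → s + (w + t) ≡ w + (s + t)
  swap = solve-∀

restrict-avoids : ∀ b {x : Vec Bool n} cs →
  All (λ c → ¬ Hits c x) (restrict b cs) → All (λ c → ¬ Hits c (b ∷ x)) cs
restrict-avoids b     []                      ps       = []
restrict-avoids b     ((nothing ∷ c) ∷ cs)    (p ∷ ps) = (λ { (free h) → p h }) ∷ restrict-avoids b cs ps
restrict-avoids true  ((just true ∷ c) ∷ cs)  (p ∷ ps) = (λ { (bind h) → p h }) ∷ restrict-avoids true cs ps
restrict-avoids true  ((just false ∷ c) ∷ cs) ps       = (λ ()) ∷ restrict-avoids true cs ps
restrict-avoids false ((just true ∷ c) ∷ cs)  ps       = (λ ()) ∷ restrict-avoids false cs ps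
restrict-avoids false ((just false ∷ c) ∷ cs) (p ∷ ps) = (λ { (bind h) → p h }) ∷ restrict-avoids false cs ps

-- Method of conditional expectations: one of the two values of the first
-- variable does not increase the expected number of clauses hit.
avoid : (cs : List (Clause n)) → totalWeight cs < 2 ^ n → ∃[ x ] All (λ c → ¬ Hits c x) cs
avoid {zero} []        _         = [] , []
-- With no variables left each clause is hit and weighs 1, so a total below 1 excludes any clause.
avoid {zero} ([] ∷ cs) (s≤s ())
avoid {suc n} cs w<
  with totalWeight (restrict true cs) <? 2 ^ n | totalWeight (restrict false cs) <? 2 ^ n
... | yes w₁< | _ = let x , ps = avoid (restrict true cs) w₁< in true ∷ x , restrict-avoids true cs ps
... | no _ | yes w₂< = let x , ps = avoid (restrict false cs) w₂< in false ∷ x , restrict-avoids false cs ps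
... | no w₁≮ | no w₂≮ = contradiction w< (≤⇒≯ (begin
  2 ^ n + (2 ^ n + 0)                                             ≡⟨ cong (2 ^ n +_) (+-identityʳ _) ⟩
  2 ^ n + 2 ^ n                                                   ≤⟨ +-mono-≤ (≮⇒≥ w₁≮) (≮⇒≥ w₂≮) ⟩
  totalWeight (restrict true cs) + totalWeight (restrict false cs) ≡⟨ totalWeight-restrict cs ⟩
  totalWeight cs                                                  ∎))
  where open ≤-Reasoning

-- Each bound variable halves the set of assignments hit.
weight-width : (c : Clause n) → 2 ^ width c * weight c ≡ 2 ^ n
weight-width []            = refl
weight-width {suc n} (nothing ∷ c) = trans (swap (2 ^ width c) (weight c)) (cong (2 *_) (weight-width c))
  where
  swap : ∀ p w → p * (2 * w) ≡ 2 * (p * w)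
  swap = solve-∀
weight-width (just _ ∷ c)  = trans (*-assoc 2 (2 ^ width c) _) (cong (2 *_) (weight-width c))

totalWeight-bound : ∀ k (cs : List (Clause n)) → All (λ c → k ≤ width c) cs →
  2 ^ k * totalWeight cs ≤ length cs * 2 ^ n
totalWeight-bound k [] [] = ≤-reflexive (*-zeroʳ (2 ^ k))
totalWeight-bound {n} k (c ∷ cs) (k≤ ∷ ks) = begin
  2 ^ k * (weight c + totalWeight cs)         ≡⟨ *-distribˡ-+ (2 ^ k) _ _ ⟩
  2 ^ k * weight c + 2 ^ k * totalWeight cs   ≤⟨ +-mono-≤ (*-monoˡ-≤ (weight c) (^-monoʳ-≤ 2 k≤)) (totalWeight-bound k cs ks) ⟩
  2 ^ width c * weight c + length cs * 2 ^ n  ≡⟨ cong (_+ length cs * 2 ^ n) (weight-width c) ⟩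
  2 ^ n + length cs * 2 ^ n                   ∎
  where open ≤-Reasoning

-- A clause of width at least `k` is hit with probability at most 1/2^k, so fewer than 2^k of them
-- give an expected number of hits below 1.
avoid-wide : ∀ k (cs : List (Clause n)) → All (λ c → k ≤ width c) cs → length cs < 2 ^ k →
  ∃[ x ] All (λ c → ¬ Hits c x) cs
avoid-wide {n} k cs wide few = avoid cs (*-cancelˡ-< (2 ^ k) _ _ (begin-strict
  2 ^ k * totalWeight cs  ≤⟨ totalWeight-bound k cs wide ⟩
  length cs * 2 ^ n       <⟨ *-monoˡ-< (2 ^ n) {{m^n≢0 2 n}} few ⟩
  2 ^ k * 2 ^ n           ∎))
  where open ≤-Reasoning

width-++ : (c : Clause m) (d : Clause n) → width (c Vec.++ d) ≡ width c + width d
width-++ []            d = refl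
width-++ (nothing ∷ c) d = width-++ c d
width-++ (just _ ∷ c)  d = cong suc (width-++ c d)

width-nothing : ∀ n → width (replicate n nothing) ≡ 0
width-nothing zero    = refl
width-nothing (suc n) = width-nothing n

Hits-++ : (c : Clause m) (d : Clause n) (x : Vec Bool (m + n)) →
  Hits c (Vec.take m x) → Hits d (Vec.drop m x) → Hits (c Vec.++ d) x
Hits-++ []            d x       []       k = k
Hits-++ (nothing ∷ c) d (b ∷ x) (free h) k = free (Hits-++ c d x h k)
Hits-++ (just _ ∷ c)  d (b ∷ x) (bind h) k = bind (Hits-++ c d x h k)

Hits-nothing : (x : Vec Bool n) → Hits (replicate n nothing) x
Hits-nothing []      = []
Hits-nothing (_ ∷ x) = free (Hits-nothing x)

-- Symmetric matrices without diagonal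

-- Each pair is stored once, in the row of its smaller vertex, so every filling is symmetric and the
-- open pairs can be chosen independently.
data Triangle (A : Set) : ℕ → Set where
  []  : Triangle A 0
  _∷_ : Vec A n → Triangle A n → Triangle A (suc n)

-- The binomial coefficient n choose 2, giving one variable for each pair of vertices.
triangular : ℕ → ℕ
triangular zero    = 0
triangular (suc n) = n + triangular n

entry : A → Triangle A n → Fin n → Fin n → A
entry d (r ∷ t) zero    zero    = d
entry d (r ∷ t) zero    (suc j) = lookup r j
entry d (r ∷ t) (suc i) zero    = lookup r i
entry d (r ∷ t) (suc i) (suc j) = entry d t i j

entry-sym : ∀ (d : A) (t : Triangle A n) i j → entry d t i j ≡ entry d t j i
entry-sym d (r ∷ t) zero    zero    = refl
entry-sym d (r ∷ t) zero    (suc j) = refl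
entry-sym d (r ∷ t) (suc i) zero    = refl
entry-sym d (r ∷ t) (suc i) (suc j) = entry-sym d t i j

entry-diag : ∀ (d : A) (t : Triangle A n) i → entry d t i i ≡ d
entry-diag d (r ∷ t) zero    = refl
entry-diag d (r ∷ t) (suc i) = entry-diag d t i

toGraph : Triangle Bool n → Graph n
toGraph t = record { adj = entry false t ; symm = entry-sym false t ; irrefl = entry-diag false t }

constant : A → ∀ n → Triangle A n
constant a zero    = []
constant a (suc n) = replicate n a ∷ constant a n

entry-constant : ∀ (d a : A) (i j : Fin n) → i ≢ j → entry d (constant a n) i j ≡ a
entry-constant d a zero    zero    i≢j = contradiction refl i≢j
entry-constant d a zero    (suc j) i≢j = lookup-replicate j a
entry-constant d a (suc i) zero    i≢j = lookup-replicate i a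
entry-constant d a (suc i) (suc j) i≢j = entry-constant d a i j (i≢j ∘ cong suc)

-- Entries "just b" are prescribed adjacencies; "nothing" marks an open pair.
Template : ℕ → Set
Template = Triangle (Maybe Bool)

-- The default `nothing` keeps the diagonal unconstrained.
Extends : Graph n → Template n → Set
Extends G F = ∀ i j {b} → entry nothing F i j ≡ just b → adj G i j ≡ b

infixr 5 _⊕_
-- All pairs between the two blocks are open; every open pair of the construction arises here.
_⊕_ : Template m → Template n → Template (m + n)
[]      ⊕ E = E
(r ∷ F) ⊕ E = (r Vec.++ replicate _ nothing) ∷ (F ⊕ E)

entry-⊕ˡ : ∀ (F : Template m) (E : Template n) i j →
  entry nothing (F ⊕ E) (i ↑ˡ n) (j ↑ˡ n) ≡ entry nothing F i j
entry-⊕ˡ (r ∷ F) E zero    zero    = refl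
entry-⊕ˡ (r ∷ F) E zero    (suc j) = lookup-++ˡ r _ j
entry-⊕ˡ (r ∷ F) E (suc i) zero    = lookup-++ˡ r _ i
entry-⊕ˡ (r ∷ F) E (suc i) (suc j) = entry-⊕ˡ F E i j

entry-⊕ʳ : ∀ (F : Template m) (E : Template n) i j →
  entry nothing (F ⊕ E) (m ↑ʳ i) (m ↑ʳ j) ≡ entry nothing E i j
entry-⊕ʳ []      E i j = refl
entry-⊕ʳ (r ∷ F) E i j = entry-⊕ʳ F E i j

complete : Template n → Vec Bool (triangular n) → Triangle Bool n
complete []              x = []
complete {suc n} (r ∷ F) x = Vec.zipWith (λ f b → fromMaybe b f) r (Vec.take n x) ∷ complete F (Vec.drop n x)

complete-extends : (F : Template n) (x : Vec Bool (triangular n)) → Extends (toGraph (complete F x)) F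
complete-extends {suc n} (r ∷ F) x zero (suc j) eq
  rewrite lookup-zipWith (λ f b → fromMaybe b f) j r (Vec.take n x) | eq = refl
complete-extends {suc n} (r ∷ F) x (suc i) zero eq
  rewrite lookup-zipWith (λ f b → fromMaybe b f) i r (Vec.take n x) | eq = refl
complete-extends (r ∷ F) x (suc i) (suc j) eq = complete-extends F _ i j eq

-- Homogeneous sets

-- Treats both colours at once: for `true` this is `IsClique` by definition, for `false` it differs
-- from `IsStable` only on the diagonal.
Homogeneous : Graph n → Bool → Subset n → Set
Homogeneous G b T = ∀ u v → u ∈ T → v ∈ T → u ≢ v → adj G u v ≡ b

homogeneous⇒stable : (G : Graph n) {T : Subset n} → Homogeneous G false T → IsStable G T
homogeneous⇒stable G h u v u∈ v∈ with u Fin.≟ v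
... | yes refl = irrefl G u
... | no u≢v   = h u v u∈ v∈ u≢v

stable⇒homogeneous : (G : Graph n) {T : Subset n} → IsStable G T → Homogeneous G false T
stable⇒homogeneous G s u v u∈ v∈ _ = s u v u∈ v∈

homogeneous-⁅⁆ : ∀ (G : Graph n) b v → Homogeneous G b ⁅ v ⁆
homogeneous-⁅⁆ G b v u w u∈ w∈ u≢w =
  contradiction (trans (x∈⁅y⁆⇒x≡y v u∈) (sym (x∈⁅y⁆⇒x≡y v w∈))) u≢w

homogeneous-insert : ∀ (G : Graph n) b {T : Subset n} v → Homogeneous G b T →
  (∀ u → u ∈ T → adj G v u ≡ b) → Homogeneous G b (⁅ v ⁆ ∪ T)
homogeneous-insert G b {T} v h a u w u∈ w∈ u≢w with x∈p∪q⁻ ⁅ v ⁆ T u∈ | x∈p∪q⁻ ⁅ v ⁆ T w∈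
... | inj₁ u∈v | inj₁ w∈v = homogeneous-⁅⁆ G b v u w u∈v w∈v u≢w
... | inj₁ u∈v | inj₂ w∈T rewrite x∈⁅y⁆⇒x≡y v u∈v = a w w∈T
... | inj₂ u∈T | inj₁ w∈v rewrite x∈⁅y⁆⇒x≡y v w∈v = trans (symm G u v) (a u u∈T)
... | inj₂ u∈T | inj₂ w∈T = h u w u∈T w∈T u≢w

homogeneous? : ∀ (G : Graph n) b T → Dec (Homogeneous G b T)
homogeneous? G b T = Fin.all? λ u → Fin.all? λ v →
  (u ∈? T) →-dec ((v ∈? T) →-dec ((¬? (u Fin.≟ v)) →-dec (adj G u v Bool.≟ b)))

rowClause : Bool → Vec (Maybe Bool) n → Subset n → Clause n
rowClause b []            []          = []
rowClause b (f ∷ r)       (false ∷ T) = nothing ∷ rowClause b r T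
rowClause b (nothing ∷ r) (true ∷ T)  = just b ∷ rowClause b r T
rowClause b (just _ ∷ r)  (true ∷ T)  = nothing ∷ rowClause b r T

-- The event that all open pairs inside `T` get the value `b`. Prescribed pairs impose no condition,
-- so it contains the event that `T` is homogeneous of colour `b`.
clause : Bool → Template n → Subset n → Clause (triangular n)
clause b []      []          = []
clause b (r ∷ F) (true ∷ T)  = rowClause b r T Vec.++ clause b F T
clause b (r ∷ F) (false ∷ T) = replicate _ nothing Vec.++ clause b F T

rowClause-hit : ∀ b (r : Vec (Maybe Bool) n) (T : Subset n) (x : Vec Bool n) →
  (∀ j → j ∈ T → lookup (Vec.zipWith (λ f c → fromMaybe c f) r x) j ≡ b) → Hits (rowClause b r T) x
rowClause-hit b []            []          []      h = []
rowClause-hit b (f ∷ r)       (false ∷ T) (c ∷ x) h = free (rowClause-hit b r T x λ j → h (suc j) ∘ there)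
rowClause-hit b (nothing ∷ r) (true ∷ T)  (c ∷ x) h with h zero here
... | refl = bind (rowClause-hit b r T x λ j → h (suc j) ∘ there)
rowClause-hit b (just _ ∷ r)  (true ∷ T)  (c ∷ x) h = free (rowClause-hit b r T x λ j → h (suc j) ∘ there)

homogeneous-tail : ∀ {b t} {r : Vec Bool n} {g : Triangle Bool n} {T : Subset n} →
  Homogeneous (toGraph (r ∷ g)) b (t ∷ T) → Homogeneous (toGraph g) b T
homogeneous-tail h u v u∈ v∈ u≢v = h (suc u) (suc v) (there u∈) (there v∈) (u≢v ∘ Fin.suc-injective)

clause-hit : ∀ b (F : Template n) (T : Subset n) (x : Vec Bool (triangular n)) →
  Homogeneous (toGraph (complete F x)) b T → Hits (clause b F T) x
clause-hit b []      []          [] h = []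
clause-hit b (r ∷ F) (true ∷ T)  x  h = Hits-++ (rowClause b r T) _ x
  (rowClause-hit b r T _ λ j j∈ → h zero (suc j) here (there j∈) λ ())
  (clause-hit b F T _ (homogeneous-tail h))
clause-hit {suc n} b (r ∷ F) (false ∷ T) x h = Hits-++ (replicate n nothing) _ x
  (Hits-nothing _) (clause-hit b F T _ (homogeneous-tail h))

-- Counting fixed and open pairs

fixedInRow : Vec (Maybe Bool) n → Subset n → ℕ
fixedInRow []            []          = 0
fixedInRow (f ∷ r)       (false ∷ T) = fixedInRow r T
fixedInRow (nothing ∷ r) (true ∷ T)  = fixedInRow r T
fixedInRow (just _ ∷ r)  (true ∷ T)  = suc (fixedInRow r T)

fixedPairs : Template n → Subset n → ℕ
fixedPairs []      []          = 0
fixedPairs (r ∷ F) (true ∷ T)  = fixedInRow r T + fixedPairs F T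
fixedPairs (r ∷ F) (false ∷ T) = fixedPairs F T

pairs : Subset n → ℕ
pairs []          = 0
pairs (true ∷ T)  = ∣ T ∣ + pairs T
pairs (false ∷ T) = pairs T

-- `pairs T` is |T| choose 2; this form avoids both division and subtraction.
pairs-square : (T : Subset n) → pairs T + pairs T + ∣ T ∣ ≡ ∣ T ∣ * ∣ T ∣
pairs-square []          = refl
pairs-square (true ∷ T)  = trans (arith ∣ T ∣ (pairs T)) (trans (cong (suc (∣ T ∣ + ∣ T ∣) +_) (pairs-square T)) (square ∣ T ∣))
  where
  arith : ∀ t p → (t + p) + (t + p) + suc t ≡ suc (t + t) + (p + p + t)
  arith = solve-∀
  square : ∀ t → suc (t + t) + t * t ≡ suc t * suc t
  square = solve-∀
pairs-square (false ∷ T) = pairs-square T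

width-rowClause : ∀ b (r : Vec (Maybe Bool) n) T → width (rowClause b r T) + fixedInRow r T ≡ ∣ T ∣
width-rowClause b []            []          = refl
width-rowClause b (f ∷ r)       (false ∷ T) = width-rowClause b r T
width-rowClause b (nothing ∷ r) (true ∷ T)  = cong suc (width-rowClause b r T)
width-rowClause b (just _ ∷ r)  (true ∷ T)  = trans (+-suc _ _) (cong suc (width-rowClause b r T))

-- Every pair inside `T` is either open, and then binds one variable of the clause, or prescribed.
width-clause : ∀ b (F : Template n) T → width (clause b F T) + fixedPairs F T ≡ pairs T
width-clause b []      []          = refl
width-clause b (r ∷ F) (true ∷ T)
  rewrite width-++ (rowClause b r T) (clause b F T) =
  trans (interchange (width (rowClause b r T)) _ _ _) (cong₂ _+_ (width-rowClause b r T) (width-clause b F T))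
  where
  interchange : ∀ p q s t → (p + q) + (s + t) ≡ (p + s) + (q + t)
  interchange = solve-∀
width-clause {suc n} b (r ∷ F) (false ∷ T)
  rewrite width-++ (replicate n nothing) (clause b F T) | width-nothing n = width-clause b F T

fixedInRow≤ : (r : Vec (Maybe Bool) n) (T : Subset n) → fixedInRow r T ≤ ∣ T ∣
fixedInRow≤ r T = subst (fixedInRow r T ≤_) (width-rowClause true r T) (m≤n+m _ (width (rowClause true r T)))

fixedPairs-∷≤ : ∀ (r : Vec (Maybe Bool) n) F t T → fixedPairs (r ∷ F) (t ∷ T) ≤ ∣ T ∣ + fixedPairs F T
fixedPairs-∷≤ r F true  T = +-monoˡ-≤ _ (fixedInRow≤ r T)
fixedPairs-∷≤ r F false T = m≤n+m _ ∣ T ∣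

-- Each of the n rows contributes at most |T| pairs. This crude estimate serves the leaves of the
-- tree, where n is at most 3.
fixedPairs≤ : (F : Template n) (T : Subset n) → fixedPairs F T ≤ n * ∣ T ∣
fixedPairs≤ []      []      = z≤n
fixedPairs≤ {suc n} (r ∷ F) (t ∷ T) = begin
  fixedPairs (r ∷ F) (t ∷ T)  ≤⟨ fixedPairs-∷≤ r F t T ⟩
  ∣ T ∣ + fixedPairs F T      ≤⟨ +-monoʳ-≤ ∣ T ∣ (fixedPairs≤ F T) ⟩
  suc n * ∣ T ∣               ≤⟨ *-monoʳ-≤ (suc n) (∣p∣≤∣x∷p∣ t T) ⟩
  suc n * ∣ t ∷ T ∣           ∎
  where open ≤-Reasoning

fixedInRow-nothing : (T : Subset n) → fixedInRow (replicate n nothing) T ≡ 0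
fixedInRow-nothing []          = refl
fixedInRow-nothing (false ∷ T) = fixedInRow-nothing T
fixedInRow-nothing (true ∷ T)  = fixedInRow-nothing T

fixedInRow-++-nothing : ∀ (r : Vec (Maybe Bool) m) S (T : Subset n) →
  fixedInRow (r Vec.++ replicate n nothing) (S Vec.++ T) ≡ fixedInRow r S
fixedInRow-++-nothing []            []          T = fixedInRow-nothing T
fixedInRow-++-nothing (f ∷ r)       (false ∷ S) T = fixedInRow-++-nothing r S T
fixedInRow-++-nothing (nothing ∷ r) (true ∷ S)  T = fixedInRow-++-nothing r S T
fixedInRow-++-nothing (just _ ∷ r)  (true ∷ S)  T = cong suc (fixedInRow-++-nothing r S T)

fixedPairs-⊕ : ∀ (F : Template m) (E : Template n) S T →
  fixedPairs (F ⊕ E) (S Vec.++ T) ≡ fixedPairs F S + fixedPairs E T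
fixedPairs-⊕ []      E []          T = refl
fixedPairs-⊕ (r ∷ F) E (false ∷ S) T = fixedPairs-⊕ F E S T
fixedPairs-⊕ (r ∷ F) E (true ∷ S)  T
  rewrite fixedInRow-++-nothing r S T | fixedPairs-⊕ F E S T = sym (+-assoc (fixedInRow r S) _ _)

∣++∣ : (S : Subset m) (T : Subset n) → ∣ S Vec.++ T ∣ ≡ ∣ S ∣ + ∣ T ∣
∣++∣ []          T = refl
∣++∣ (false ∷ S) T = ∣++∣ S T
∣++∣ (true ∷ S)  T = cong suc (∣++∣ S T)

-- The union bound

subsetsOfSize : ∀ n → ℕ → List (Subset n)
subsetsOfSize n       zero    = ⊥ ∷ []
subsetsOfSize zero    (suc k) = []
subsetsOfSize (suc n) (suc k) = map (true ∷_) (subsetsOfSize n k) ++ map (false ∷_) (subsetsOfSize n (suc k))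

length-subsetsOfSize : ∀ n k → length (subsetsOfSize n k) ≤ n ^ k
length-subsetsOfSize n       zero    = ≤-refl
length-subsetsOfSize zero    (suc k) = z≤n
length-subsetsOfSize (suc n) (suc k) = begin
  length (map (true ∷_) (subsetsOfSize n k) ++ map (false ∷_) (subsetsOfSize n (suc k)))
    ≡⟨ length-++ (map (true ∷_) (subsetsOfSize n k)) ⟩
  length (map (true ∷_) (subsetsOfSize n k)) + length (map (false ∷_) (subsetsOfSize n (suc k)))
    ≡⟨ cong₂ _+_ (length-map _ (subsetsOfSize n k)) (length-map _ (subsetsOfSize n (suc k))) ⟩
  length (subsetsOfSize n k) + length (subsetsOfSize n (suc k))
    ≤⟨ +-mono-≤ (length-subsetsOfSize n k) (length-subsetsOfSize n (suc k)) ⟩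
  suc n * n ^ k
    ≤⟨ *-monoʳ-≤ (suc n) (^-monoˡ-≤ k (n≤1+n n)) ⟩
  suc n * suc n ^ k ∎
  where open ≤-Reasoning

∈-subsetsOfSize : ∀ k (T : Subset n) → ∣ T ∣ ≡ k → T List.∈ subsetsOfSize n k
∈-subsetsOfSize zero    []          eq = here refl
∈-subsetsOfSize zero    (false ∷ T) eq with ∈-subsetsOfSize zero T eq
... | here refl = here refl
∈-subsetsOfSize (suc k) (true ∷ T)  eq = ∈-++⁺ˡ (∈-map⁺ _ (∈-subsetsOfSize k T (suc-injective eq)))
∈-subsetsOfSize (suc k) (false ∷ T) eq = ∈-++⁺ʳ _ (∈-map⁺ _ (∈-subsetsOfSize (suc k) T eq))

subsetsOfSize-size : ∀ n k {T} → T List.∈ subsetsOfSize n k → ∣ T ∣ ≡ k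
subsetsOfSize-size n       zero    (here refl) = ∣⊥∣≡0 n
subsetsOfSize-size (suc n) (suc k) T∈ with ∈-++⁻ (map (true ∷_) (subsetsOfSize n k)) T∈
... | inj₁ p with ∈-map⁻ _ p
...   | _ , S∈ , refl = cong suc (subsetsOfSize-size n k S∈)
subsetsOfSize-size (suc n) (suc k) T∈ | inj₂ p with ∈-map⁻ _ p
...   | _ , S∈ , refl = subsetsOfSize-size n (suc k) S∈

-- Homogeneity passes to subsets, so the union bound has to treat only sets of exactly `k` vertices.
shrink : ∀ k (T : Subset n) → k ≤ ∣ T ∣ → ∃[ S ] (S ⊆ T × ∣ S ∣ ≡ k)
shrink {n} zero T       _  = ⊥ , ⊥⊆ , ∣⊥∣≡0 n
shrink (suc k) (true ∷ T)  (s≤s k≤) = let S , S⊆T , eq = shrink k T k≤ in true ∷ S , s⊆s S⊆T , cong suc eq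
shrink (suc k) (false ∷ T) k≤       = let S , S⊆T , eq = shrink (suc k) T k≤ in false ∷ S , s⊆s S⊆T , eq

-- There are at most 2 n^k bad events, one for each colour and each `k`-set, and each has
-- probability at most 1/2^w.
ramsey-completion : ∀ k w (F : Template n) →
  (∀ b T → ∣ T ∣ ≡ k → w ≤ width (clause b F T)) → 2 * n ^ k < 2 ^ w →
  ∃[ x ] (∀ b T → Homogeneous (toGraph (complete F x)) b T → ∣ T ∣ < k)
ramsey-completion {n} k w F wide few = proj₁ sol , bound
  where
  clauses : Bool → List (Clause (triangular n))
  clauses b = map (clause b F) (subsetsOfSize n k)

  all : List (Clause (triangular n))
  all = clauses true ++ clauses false

  ∈-all : ∀ b {T} → ∣ T ∣ ≡ k → clause b F T List.∈ all
  ∈-all true  eq = ∈-++⁺ˡ (∈-map⁺ _ (∈-subsetsOfSize k _ eq))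
  ∈-all false eq = ∈-++⁺ʳ (clauses true) (∈-map⁺ _ (∈-subsetsOfSize k _ eq))

  wide-map : ∀ b {c} → c List.∈ clauses b → w ≤ width c
  wide-map b c∈ with ∈-map⁻ _ c∈
  ... | T , T∈ , refl = wide b T (subsetsOfSize-size n k T∈)

  all-wide : All (λ c → w ≤ width c) all
  all-wide = All.tabulate λ c∈ → case ∈-++⁻ (clauses true) c∈ of λ where
    (inj₁ p) → wide-map true p
    (inj₂ p) → wide-map false p

  length-all : length all ≤ 2 * n ^ k
  length-all = begin
    length all
      ≡⟨ length-++ (clauses true) ⟩
    length (clauses true) + length (clauses false)
      ≡⟨ cong₂ _+_ (length-map _ (subsetsOfSize n k)) (length-map _ (subsetsOfSize n k)) ⟩
    length (subsetsOfSize n k) + length (subsetsOfSize n k)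
      ≤⟨ +-mono-≤ (length-subsetsOfSize n k) (length-subsetsOfSize n k) ⟩
    n ^ k + n ^ k
      ≡⟨ cong (n ^ k +_) (+-identityʳ _) ⟨
    2 * n ^ k ∎
    where open ≤-Reasoning

  sol : ∃[ x ] All (λ c → ¬ Hits c x) all
  sol = avoid-wide w all all-wide (≤-<-trans length-all few)

  bound : ∀ b T → Homogeneous (toGraph (complete F (proj₁ sol))) b T → ∣ T ∣ < k
  bound b T h = ≰⇒> λ k≤ →
    let S , S⊆T , eq = shrink k T k≤
    in All.lookup (proj₂ sol) (∈-all b eq)
         (clause-hit b F S (proj₁ sol) λ u v u∈ v∈ → h u v (S⊆T u∈) (S⊆T v∈))

-- Joining normal graphs

induced : Graph n → (Fin m → Fin n) → Graph m
induced G e = record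
  { adj    = λ u v → adj G (e u) (e v)
  ; symm   = λ u v → symm G (e u) (e v)
  ; irrefl = λ v → irrefl G (e v)
  }

-- Injectivity is expressed by the preservation of cardinalities.
record Embedding (m n : ℕ) : Set where
  field
    emb       : Fin m → Fin n
    image     : Subset m → Subset n
    ∈-image⁺  : ∀ {u T} → u ∈ T → emb u ∈ image T
    ∈-image⁻  : ∀ {v} T → v ∈ image T → ∃[ u ] (u ∈ T × v ≡ emb u)
    ∣image∣   : ∀ T → ∣ image T ∣ ≡ ∣ T ∣
open Embedding

homogeneous-image : ∀ (G : Graph n) (e : Embedding m n) b {T} →
  Homogeneous (induced G (emb e)) b T → Homogeneous G b (image e T)
homogeneous-image G e b {T} h u v u∈ v∈ u≢v with ∈-image⁻ e T u∈ | ∈-image⁻ e T v∈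
... | u′ , u′∈ , refl | v′ , v′∈ , refl = h u′ v′ u′∈ v′∈ (u≢v ∘ cong (emb e))

homogeneous-cone : ∀ (G : Graph n) (e : Embedding m n) b v → (∀ u → adj G v (emb e u) ≡ b) →
  ∀ {T} → Homogeneous (induced G (emb e)) b T → Homogeneous G b (⁅ v ⁆ ∪ image e T)
homogeneous-cone G e b v a {T} h = homogeneous-insert G b v (homogeneous-image G e b h) λ u u∈ →
  case ∈-image⁻ e T u∈ of λ { (u′ , _ , refl) → a u′ }

module _ {k} (G : Graph k) (e₁ : Embedding m k) (e₂ : Embedding n k) (x y : Fin k)
  (covered : ∀ v → (v ≡ x ⊎ v ≡ y) ⊎ ((∃[ u ] v ≡ emb e₁ u) ⊎ (∃[ u ] v ≡ emb e₂ u)))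
  (x~e₁ : ∀ u → adj G x (emb e₁ u) ≡ true) (x≁e₂ : ∀ u → adj G x (emb e₂ u) ≡ false)
  (y≁e₁ : ∀ u → adj G y (emb e₁ u) ≡ false) (y~e₂ : ∀ u → adj G y (emb e₂ u) ≡ true)
  where

  private
    cones : ∀ {a b} → Fin k → Embedding a k → Fin k → Embedding b k →
      List (Subset a) → List (Subset b) → List (Subset k)
    cones v e w f 𝒳 𝒴 = map (λ X → ⁅ v ⁆ ∪ image e X) 𝒳 ++ map (λ Y → ⁅ w ⁆ ∪ image f Y) 𝒴

    cones-elim : ∀ {a b} v (e : Embedding a k) w (f : Embedding b k) {𝒳 𝒴} (P : Subset k → Set) →
      (∀ X → X List.∈ 𝒳 → P (⁅ v ⁆ ∪ image e X)) → (∀ Y → Y List.∈ 𝒴 → P (⁅ w ⁆ ∪ image f Y)) →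
      ∀ Z → Z List.∈ cones v e w f 𝒳 𝒴 → P Z
    cones-elim v e w f {𝒳} P p q Z Z∈ with ∈-++⁻ (map (λ X → ⁅ v ⁆ ∪ image e X) 𝒳) Z∈
    ... | inj₁ Z∈₁ with ∈-map⁻ _ Z∈₁
    ...   | X , X∈ , refl = p X X∈
    cones-elim v e w f P p q Z Z∈ | inj₂ Z∈₂ with ∈-map⁻ _ Z∈₂
    ...   | Y , Y∈ , refl = q Y Y∈

    apex∈ : ∀ {a} v (e : Embedding a k) X → v ∈ ⁅ v ⁆ ∪ image e X
    apex∈ v e X = x∈p∪q⁺ (inj₁ (x∈⁅x⁆ v))

    base∈ : ∀ {a} v (e : Embedding a k) {u X} → u ∈ X → emb e u ∈ ⁅ v ⁆ ∪ image e X
    base∈ v e u∈ = x∈p∪q⁺ (inj₂ (∈-image⁺ e u∈))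

  -- Sets over the same part meet inside it. A clique and a stable set over different parts share an
  -- apex: `x` for a clique over `e₁`, `y` for one over `e₂`. No set of either family contains both
  -- apexes or vertices of both parts, so those pairs are arbitrary.
  normal-join : Fin m → Fin n → IsNormal (induced G (emb e₁)) → IsNormal (induced G (emb e₂)) → IsNormal G
  normal-join u₁ u₂ (𝒞₁ , 𝒮₁ , clique₁ , stable₁ , 𝒞₁-covers , 𝒮₁-covers , meet₁)
                    (𝒞₂ , 𝒮₂ , clique₂ , stable₂ , 𝒞₂-covers , 𝒮₂-covers , meet₂) =
    𝒞 , 𝒮 ,
    cones-elim x e₁ y e₂ (IsClique G)
      (λ C C∈ → homogeneous-cone G e₁ true x x~e₁ (clique₁ C C∈))
      (λ C C∈ → homogeneous-cone G e₂ true y y~e₂ (clique₂ C C∈)) ,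
    cones-elim y e₁ x e₂ (IsStable G)
      (λ S S∈ → homogeneous⇒stable G (homogeneous-cone G e₁ false y y≁e₁
        (stable⇒homogeneous (induced G (emb e₁)) (stable₁ S S∈))))
      (λ S S∈ → homogeneous⇒stable G (homogeneous-cone G e₂ false x x≁e₂
        (stable⇒homogeneous (induced G (emb e₂)) (stable₂ S S∈)))) ,
    𝒞-covers , 𝒮-covers ,
    λ C S C∈ S∈ → cones-elim x e₁ y e₂ (λ C → ∃[ v ] (v ∈ C × v ∈ S))
      (λ C₁ C₁∈ → cones-elim y e₁ x e₂ (λ S → ∃[ v ] (v ∈ ⁅ x ⁆ ∪ image e₁ C₁ × v ∈ S))
        (λ S₁ S₁∈ → let v , v∈C , v∈S = meet₁ C₁ S₁ C₁∈ S₁∈ in emb e₁ v , base∈ x e₁ v∈C , base∈ y e₁ v∈S)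
        (λ S₂ S₂∈ → x , apex∈ x e₁ C₁ , apex∈ x e₂ S₂) S S∈)
      (λ C₂ C₂∈ → cones-elim y e₁ x e₂ (λ S → ∃[ v ] (v ∈ ⁅ y ⁆ ∪ image e₂ C₂ × v ∈ S))
        (λ S₁ S₁∈ → y , apex∈ y e₂ C₂ , apex∈ y e₁ S₁)
        (λ S₂ S₂∈ → let v , v∈C , v∈S = meet₂ C₂ S₂ C₂∈ S₂∈ in emb e₂ v , base∈ y e₂ v∈C , base∈ x e₂ v∈S) S S∈)
      C C∈
    where
    𝒞 𝒮 : List (Subset k)
    𝒞 = cones x e₁ y e₂ 𝒞₁ 𝒞₂
    𝒮 = cones y e₁ x e₂ 𝒮₁ 𝒮₂

    𝒞-covers : Covers G 𝒞
    𝒞-covers v with covered v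
    -- An apex is covered once the family below it has a member; the set covering a vertex of the
    -- nonempty part is one.
    ... | inj₁ (inj₁ refl) = let C , C∈ , _ = 𝒞₁-covers u₁ in _ , ∈-++⁺ˡ (∈-map⁺ _ C∈) , apex∈ x e₁ C
    ... | inj₁ (inj₂ refl) = let C , C∈ , _ = 𝒞₂-covers u₂ in _ , ∈-++⁺ʳ _ (∈-map⁺ _ C∈) , apex∈ y e₂ C
    ... | inj₂ (inj₁ (u , refl)) = let C , C∈ , u∈ = 𝒞₁-covers u in _ , ∈-++⁺ˡ (∈-map⁺ _ C∈) , base∈ x e₁ u∈
    ... | inj₂ (inj₂ (u , refl)) = let C , C∈ , u∈ = 𝒞₂-covers u in _ , ∈-++⁺ʳ _ (∈-map⁺ _ C∈) , base∈ y e₂ u∈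

    𝒮-covers : Covers G 𝒮
    𝒮-covers v with covered v
    ... | inj₁ (inj₁ refl) = let S , S∈ , _ = 𝒮₂-covers u₂ in _ , ∈-++⁺ʳ _ (∈-map⁺ _ S∈) , apex∈ x e₂ S
    ... | inj₁ (inj₂ refl) = let S , S∈ , _ = 𝒮₁-covers u₁ in _ , ∈-++⁺ˡ (∈-map⁺ _ S∈) , apex∈ y e₁ S
    ... | inj₂ (inj₁ (u , refl)) = let S , S∈ , u∈ = 𝒮₁-covers u in _ , ∈-++⁺ˡ (∈-map⁺ _ S∈) , base∈ y e₁ u∈
    ... | inj₂ (inj₂ (u , refl)) = let S , S∈ , u∈ = 𝒮₂-covers u in _ , ∈-++⁺ʳ _ (∈-map⁺ _ S∈) , base∈ x e₂ u∈

-- The singletons serve as cliques and the whole vertex set as the only stable set.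
normal-edgeless : (G : Graph n) → (∀ u v → adj G u v ≡ false) → IsNormal G
normal-edgeless {n} G edgeless =
  map ⁅_⁆ (allFin n) , ⊤ ∷ [] ,
  (λ C C∈ → case ∈-map⁻ _ C∈ of λ { (v , _ , refl) → homogeneous-⁅⁆ G true v }) ,
  (λ { _ (here refl) u v _ _ → edgeless u v }) ,
  (λ v → ⁅ v ⁆ , ∈-map⁺ _ (∈-allFin v) , x∈⁅x⁆ v) ,
  (λ v → ⊤ , here refl , ∈⊤) ,
  (λ { C _ C∈ (here refl) → case ∈-map⁻ _ C∈ of λ { (v , _ , refl) → v , x∈⁅x⁆ v , ∈⊤ } })

-- The two parts and the two apexes of a join

∈-++ˡ⁺ : ∀ {u : Fin m} {S} {T : Subset n} → u ∈ S → (u ↑ˡ n) ∈ (S Vec.++ T)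
∈-++ˡ⁺ here      = here
∈-++ˡ⁺ (there p) = there (∈-++ˡ⁺ p)

∈-++ʳ⁺ : ∀ (S : Subset m) {u : Fin n} {T} → u ∈ T → (m ↑ʳ u) ∈ (S Vec.++ T)
∈-++ʳ⁺ []      p = p
∈-++ʳ⁺ (_ ∷ S) p = there (∈-++ʳ⁺ S p)

∈-++⊥⁻ : ∀ {v} (T : Subset m) → v ∈ (T Vec.++ ⊥ {n}) → ∃[ u ] (u ∈ T × v ≡ u ↑ˡ n)
∈-++⊥⁻ []      p         = contradiction p ∉⊥
∈-++⊥⁻ (_ ∷ T) here      = zero , here , refl
∈-++⊥⁻ (_ ∷ T) (there p) = let u , u∈ , eq = ∈-++⊥⁻ T p in suc u , there u∈ , cong suc eq

∈-⊥++⁻ : ∀ m {v} (T : Subset n) → v ∈ (⊥ {m} Vec.++ T) → ∃[ u ] (u ∈ T × v ≡ m ↑ʳ u)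
∈-⊥++⁻ zero    T p         = _ , p , refl
∈-⊥++⁻ (suc m) T (there p) = let u , u∈ , eq = ∈-⊥++⁻ m T p in u , u∈ , cong suc eq

-- Vertices 0 and 1 are the apexes x and y; the m vertices of the first part follow, then the n of
-- the second.
leftPart : ∀ m n → Embedding m (2 + (m + n))
leftPart m n = record
  { emb      = λ u → suc (suc (u ↑ˡ n))
  ; image    = λ T → false ∷ false ∷ (T Vec.++ ⊥)
  ; ∈-image⁺ = λ u∈ → there (there (∈-++ˡ⁺ u∈))
  ; ∈-image⁻ = λ { T (there (there p)) → let u , u∈ , eq = ∈-++⊥⁻ T p in u , u∈ , cong (2 ↑ʳ_) eq }
  ; ∣image∣  = λ T → trans (∣++∣ T ⊥) (trans (cong (∣ T ∣ +_) (∣⊥∣≡0 n)) (+-identityʳ _))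
  }

rightPart : ∀ m n → Embedding n (2 + (m + n))
rightPart m n = record
  { emb      = λ u → suc (suc (m ↑ʳ u))
  ; image    = λ T → false ∷ false ∷ (⊥ Vec.++ T)
  ; ∈-image⁺ = λ u∈ → there (there (∈-++ʳ⁺ ⊥ u∈))
  ; ∈-image⁻ = λ { T (there (there p)) → let u , u∈ , eq = ∈-⊥++⁻ m T p in u , u∈ , cong (2 ↑ʳ_) eq }
  ; ∣image∣  = λ T → trans (∣++∣ (⊥ {m}) T) (cong (_+ ∣ T ∣) (∣⊥∣≡0 m))
  }

split-view : ∀ m {n} (v : Fin (m + n)) → (∃[ u ] v ≡ u ↑ˡ n) ⊎ (∃[ u ] v ≡ m ↑ʳ u)
split-view zero    v       = inj₂ (v , refl)
split-view (suc m) zero    = inj₁ (zero , refl)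
split-view (suc m) (suc v) with split-view m v
... | inj₁ (u , eq) = inj₁ (suc u , cong suc eq)
... | inj₂ (u , eq) = inj₂ (u , cong suc eq)

-- The rows are those of x, of y and of the two parts. Normality allows either value for the pair x,
-- y; it is set to `false`.
joined : Template m → Template n → Template (2 + (m + n))
joined {m} {n} F E =
  (just false ∷ (replicate m (just true) Vec.++ replicate n (just false))) ∷
  (replicate m (just false) Vec.++ replicate n (just true)) ∷
  (F ⊕ E)

joined-covered : ∀ m n (v : Fin (2 + (m + n))) →
  (v ≡ zero ⊎ v ≡ suc zero) ⊎ ((∃[ u ] v ≡ emb (leftPart m n) u) ⊎ (∃[ u ] v ≡ emb (rightPart m n) u))
joined-covered m n zero          = inj₁ (inj₁ refl)
joined-covered m n (suc zero)    = inj₁ (inj₂ refl)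
joined-covered m n (suc (suc v)) with split-view m v
... | inj₁ (u , eq) = inj₂ (inj₁ (u , cong (2 ↑ʳ_) eq))
... | inj₂ (u , eq) = inj₂ (inj₂ (u , cong (2 ↑ʳ_) eq))

lookup-blocksˡ : ∀ (a b : A) (u : Fin m) → lookup (replicate m a Vec.++ replicate n b) (u ↑ˡ n) ≡ a
lookup-blocksˡ a b u = trans (lookup-++ˡ (replicate _ a) _ u) (lookup-replicate u a)

lookup-blocksʳ : ∀ (a b : A) (u : Fin n) → lookup (replicate m a Vec.++ replicate n b) (m ↑ʳ u) ≡ b
lookup-blocksʳ {m = m} a b u = trans (lookup-++ʳ (replicate m a) _ u) (lookup-replicate u b)

-- Templates along a balanced binary tree

-- The last two fields hold for every completion of the open pairs. `ℓ` bounds the depth of the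
-- tree: in `sparse` a leaf accounts for 3 and each level for 2. `large` says that |T| is at least
-- half of log₂ n.
record Scheme (ℓ n : ℕ) : Set where
  field
    template : Template n
    sparse   : ∀ T → fixedPairs template T ≤ (3 + 2 * ℓ) * ∣ T ∣
    normal   : ∀ G → Extends G template → IsNormal G
    large    : ∀ G → Extends G template → ∀ b → ∃[ T ] (Homogeneous G b T × n ≤ 4 ^ ∣ T ∣)
open Scheme

edgeless-scheme : ∀ ℓ n → 1 ≤ n → n ≤ 3 → Scheme ℓ n
edgeless-scheme ℓ (suc n) _ n≤3 = record
  { template = constant (just false) (suc n)
  ; sparse   = λ T → ≤-trans (fixedPairs≤ (constant (just false) (suc n)) T)
                       (*-monoˡ-≤ ∣ T ∣ (≤-trans n≤3 (m≤m+n 3 (2 * ℓ))))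
  ; normal   = λ G ext → normal-edgeless G λ u v → case u Fin.≟ v of λ where
      (yes refl) → irrefl G u
      (no u≢v)   → ext u v (entry-constant nothing (just false) u v u≢v)
  ; large    = λ G ext b → ⁅ zero ⁆ , homogeneous-⁅⁆ G b zero ,
      subst (λ s → suc n ≤ 4 ^ s) (sym (∣⁅x⁆∣≡1 (zero {n}))) (m≤n⇒m≤1+n n≤3)
  }

-- The rows of the two apexes add at most 2|T| prescribed pairs. An apex enlarges a homogeneous set
-- of the second, larger part by one vertex, while the number of vertices grows at most fourfold.
join-scheme : ∀ {ℓ} → 1 ≤ m → m ≤ n → Scheme ℓ m → Scheme ℓ n → Scheme (suc ℓ) (2 + (m + n))
join-scheme {m = m@(suc _)} {n = n@(suc _)} {ℓ} _ m≤n P Q = record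
  { template = F
  ; sparse   = sparse′
  ; normal   = λ G ext → normal-join G (leftPart m n) (rightPart m n) zero (suc zero) (joined-covered m n)
      (x~left G ext) (x≁right G ext) (y≁left G ext) (y~right G ext)
      zero zero (normal P (induced G (emb (leftPart m n))) (left-extends G ext))
      (normal Q (induced G (emb (rightPart m n))) (right-extends G ext))
  ; large    = large′
  }
  where
  F : Template (2 + (m + n))
  F = joined (template P) (template Q)

  sparse′ : ∀ T → fixedPairs F T ≤ (3 + 2 * suc ℓ) * ∣ T ∣
  sparse′ T₀@(t ∷ u ∷ T) with Vec.splitAt m T
  ... | S , R , refl = begin
    fixedPairs F T₀
      ≤⟨ fixedPairs-∷≤ _ (row ∷ F⊕E) t (u ∷ T) ⟩
    ∣ u ∷ T ∣ + fixedPairs (row ∷ F⊕E) (u ∷ T)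
      ≤⟨ +-monoʳ-≤ ∣ u ∷ T ∣ (fixedPairs-∷≤ row F⊕E u T) ⟩
    ∣ u ∷ T ∣ + (∣ T ∣ + fixedPairs F⊕E T)
      ≡⟨ cong (λ f → ∣ u ∷ T ∣ + (∣ T ∣ + f)) (fixedPairs-⊕ (template P) (template Q) S R) ⟩
    ∣ u ∷ T ∣ + (∣ T ∣ + (fixedPairs (template P) S + fixedPairs (template Q) R))
      ≤⟨ +-monoʳ-≤ ∣ u ∷ T ∣ (+-monoʳ-≤ ∣ T ∣ (+-mono-≤ (sparse P S) (sparse Q R))) ⟩
    ∣ u ∷ T ∣ + (∣ T ∣ + (D * ∣ S ∣ + D * ∣ R ∣))
      ≡⟨ cong (λ d → ∣ u ∷ T ∣ + (∣ T ∣ + d)) (trans (sym (*-distribˡ-+ D ∣ S ∣ ∣ R ∣)) (cong (D *_) (sym (∣++∣ S R)))) ⟩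
    ∣ u ∷ T ∣ + (∣ T ∣ + D * ∣ T ∣)
      ≤⟨ +-mono-≤ (∣p∣≤∣x∷p∣ t (u ∷ T)) (+-mono-≤ T≤T₀ (*-monoʳ-≤ D T≤T₀)) ⟩
    ∣ T₀ ∣ + (∣ T₀ ∣ + D * ∣ T₀ ∣)
      ≡⟨ arith ℓ ∣ T₀ ∣ ⟩
    (3 + 2 * suc ℓ) * ∣ T₀ ∣ ∎
    where
    open ≤-Reasoning
    D : ℕ
    D = 3 + 2 * ℓ
    row : Vec (Maybe Bool) (m + n)
    row = replicate m (just false) Vec.++ replicate n (just true)
    F⊕E : Template (m + n)
    F⊕E = template P ⊕ template Q
    T≤T₀ : ∣ T ∣ ≤ ∣ T₀ ∣
    T≤T₀ = ≤-trans (∣p∣≤∣x∷p∣ u T) (∣p∣≤∣x∷p∣ t (u ∷ T))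
    arith : ∀ l s → s + (s + (3 + 2 * l) * s) ≡ (3 + 2 * (1 + l)) * s
    arith = solve-∀

  module _ (G : Graph (2 + (m + n))) (ext : Extends G F) where
    x~left : ∀ u → adj G zero (emb (leftPart m n) u) ≡ true
    x~left u = ext zero _ (lookup-blocksˡ (just true) (just false) u)
    x≁right : ∀ u → adj G zero (emb (rightPart m n) u) ≡ false
    x≁right u = ext zero _ (lookup-blocksʳ {m = m} (just true) (just false) u)
    y≁left : ∀ u → adj G (suc zero) (emb (leftPart m n) u) ≡ false
    y≁left u = ext (suc zero) _ (lookup-blocksˡ (just false) (just true) u)
    y~right : ∀ u → adj G (suc zero) (emb (rightPart m n) u) ≡ true
    y~right u = ext (suc zero) _ (lookup-blocksʳ {m = m} (just false) (just true) u)
    left-extends : Extends (induced G (emb (leftPart m n))) (template P)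
    left-extends i j eq = ext _ _ (trans (entry-⊕ˡ (template P) (template Q) i j) eq)
    right-extends : Extends (induced G (emb (rightPart m n))) (template Q)
    right-extends i j eq = ext _ _ (trans (entry-⊕ʳ (template P) (template Q) i j) eq)

    size : 2 + (m + n) ≤ 4 * n
    size = begin
      2 + (m + n)        ≤⟨ +-mono-≤ (*-monoʳ-≤ 2 {1} {n} (s≤s z≤n)) (+-monoˡ-≤ n m≤n) ⟩
      2 * n + (n + n)    ≡⟨ arith n ⟩
      4 * n              ∎
      where
      open ≤-Reasoning
      arith : ∀ k → 2 * k + (k + k) ≡ 4 * k
      arith = solve-∀

    cone-large : ∀ v T → v ∉ image (rightPart m n) T → n ≤ 4 ^ ∣ T ∣ →
      2 + (m + n) ≤ 4 ^ ∣ ⁅ v ⁆ ∪ image (rightPart m n) T ∣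
    cone-large v T v∉ n≤ = begin
      2 + (m + n)           ≤⟨ size ⟩
      4 * n                 ≤⟨ *-monoʳ-≤ 4 n≤ ⟩
      4 ^ suc ∣ T ∣         ≡⟨ cong (λ s → 4 ^ suc s) (∣image∣ (rightPart m n) T) ⟨
      4 ^ suc ∣ image (rightPart m n) T ∣
        ≤⟨ ^-monoʳ-≤ 4 (p⊂q⇒∣p∣<∣q∣ ((λ u∈ → x∈p∪q⁺ (inj₂ u∈)) , v , x∈p∪q⁺ (inj₁ (x∈⁅x⁆ v)) , v∉)) ⟩
      4 ^ ∣ ⁅ v ⁆ ∪ image (rightPart m n) T ∣ ∎
      where open ≤-Reasoning

    large′ : ∀ b → ∃[ T ] (Homogeneous G b T × 2 + (m + n) ≤ 4 ^ ∣ T ∣)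
    -- The apex y extends a clique of the second part, x a stable set.
    large′ b with large Q (induced G (emb (rightPart m n))) right-extends b
    large′ true  | T , h , n≤ = _ , homogeneous-cone G (rightPart m n) true (suc zero) y~right h , cone-large (suc zero) T (λ { (there ()) }) n≤
    large′ false | T , h , n≤ = _ , homogeneous-cone G (rightPart m n) false zero x≁right h , cone-large zero T (λ ()) n≤

-- Two vertices become apexes and the rest is halved. Both halves are nonempty from four vertices
-- on, so smaller graphs are leaves.
scheme : ∀ ℓ n → 1 ≤ n → n ≤ 2 ^ ℓ → Scheme ℓ n
scheme ℓ       1 1≤n _ = edgeless-scheme ℓ 1 1≤n (s≤s z≤n)
scheme ℓ       2 1≤n _ = edgeless-scheme ℓ 2 1≤n (s≤s (s≤s z≤n))
scheme ℓ       3 1≤n _ = edgeless-scheme ℓ 3 1≤n ≤-refl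
scheme zero    (suc (suc (suc (suc k)))) _ (s≤s ())
scheme (suc ℓ) (suc (suc (suc (suc k)))) _ n≤ =
  subst (Scheme (suc ℓ)) (cong (2 +_) (⌊n/2⌋+⌈n/2⌉≡n (2 + k)))
    (join-scheme (s≤s z≤n) halves≤
      (scheme ℓ ⌊ 2 + k /2⌋ (s≤s z≤n) (≤-trans halves≤ half≤))
      (scheme ℓ ⌈ 2 + k /2⌉ (s≤s z≤n) half≤))
  where
  open ≤-Reasoning
  halves≤ : ⌊ 2 + k /2⌋ ≤ ⌈ 2 + k /2⌉
  halves≤ = ⌊n/2⌋≤⌈n/2⌉ (2 + k)
  half≤ : ⌈ 2 + k /2⌉ ≤ 2 ^ ℓ
  half≤ = begin
    ⌈ 2 + k /2⌉           ≤⟨ n≤1+n _ ⟩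
    ⌈ 4 + k /2⌉           ≤⟨ ⌈n/2⌉-mono n≤ ⟩
    ⌈ 2 ^ suc ℓ /2⌉       ≡⟨ cong (λ s → ⌈ 2 ^ ℓ + s /2⌉) (+-identityʳ _) ⟩
    ⌈ 2 ^ ℓ + 2 ^ ℓ /2⌉   ≡⟨ n≡⌈n+n/2⌉ (2 ^ ℓ) ⟨
    2 ^ ℓ                 ∎

-- Numerical bounds

-- For sets of cℓ vertices the claim reduces to c²ℓ² ≥ 6cℓ² + 7cℓ + 4, and 14 is the least natural
-- number c for which this holds for all ℓ ≥ 1.
open-pairs-bound : ∀ ℓ w f p → 1 ≤ ℓ → w + f ≡ p → f ≤ (3 + 2 * ℓ) * (14 * ℓ) →
  p + p + 14 * ℓ ≡ 14 * ℓ * (14 * ℓ) → 2 + ℓ * (14 * ℓ) ≤ w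
open-pairs-bound (suc l) w f p _ eq f≤ sq = ≮⇒≥ λ w< → <-irrefl sq (begin-strict
  p + p + 14 * ℓ
    ≡⟨ cong (λ q → q + q + 14 * ℓ) eq ⟨
  (w + f) + (w + f) + 14 * ℓ
    <⟨ +-monoˡ-< (14 * ℓ) (+-mono-< (+-mono-<-≤ w< f≤) (+-mono-<-≤ w< f≤)) ⟩
  (2 + ℓ * (14 * ℓ) + (3 + 2 * ℓ) * (14 * ℓ)) + (2 + ℓ * (14 * ℓ) + (3 + 2 * ℓ) * (14 * ℓ)) + 14 * ℓ
    -- The slack 112ℓ² - 98ℓ - 4, rewritten in l = ℓ - 1 so that all coefficients are positive.
    ≤⟨ m≤m+n _ (10 + 126 * l + 112 * (l * l)) ⟩
  (2 + ℓ * (14 * ℓ) + (3 + 2 * ℓ) * (14 * ℓ)) + (2 + ℓ * (14 * ℓ) + (3 + 2 * ℓ) * (14 * ℓ)) + 14 * ℓ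
    + (10 + 126 * l + 112 * (l * l))
    ≡⟨ arith l ⟩
  14 * ℓ * (14 * ℓ) ∎)
  where
  open ≤-Reasoning
  ℓ : ℕ
  ℓ = suc l
  arith : ∀ l → (2 + (1 + l) * (14 * (1 + l)) + (3 + 2 * (1 + l)) * (14 * (1 + l)))
    + (2 + (1 + l) * (14 * (1 + l)) + (3 + 2 * (1 + l)) * (14 * (1 + l))) + 14 * (1 + l)
    + (10 + 126 * l + 112 * (l * l)) ≡ 14 * (1 + l) * (14 * (1 + l))
  arith = solve-∀

-- The exponent is ⌈log₂ n⌉: it grows only when n passes a power of two. Bounding by n² instead of
-- 2n keeps later estimates pure powers of n.
power-of-two-near : ∀ n → 2 ≤ n → ∃[ ℓ ] (1 ≤ ℓ × n ≤ 2 ^ ℓ × 2 ^ ℓ ≤ n ^ 2)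
power-of-two-near 1 (s≤s ())
power-of-two-near 2 _ = 1 , ≤-refl , ≤-refl , s≤s (s≤s z≤n)
power-of-two-near (suc n@(suc (suc _))) _ with power-of-two-near n (s≤s (s≤s z≤n))
... | ℓ , 1≤ℓ , n≤ , ≤n² with suc n ≤? 2 ^ ℓ
...   | yes 1+n≤ = ℓ , 1≤ℓ , 1+n≤ , ≤-trans ≤n² (^-monoˡ-≤ 2 (n≤1+n n))
...   | no  1+n≰ = suc ℓ , s≤s z≤n , subst (λ p → suc n ≤ 2 * p) n≡ (+-mono-≤ {1} {n} (s≤s z≤n) (m≤m+n n 0)) , (begin
  2 * 2 ^ ℓ            ≡⟨ cong (2 *_) n≡ ⟨
  2 * n                ≤⟨ *-mono-≤ {2} {suc n} (s≤s (s≤s z≤n)) (n≤1+n n) ⟩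
  suc n * suc n        ≡⟨ cong (suc n *_) (*-identityʳ (suc n)) ⟨
  suc n ^ 2            ∎)
  where
  open ≤-Reasoning
  n≡ : n ≡ 2 ^ ℓ
  n≡ = ≤-antisym n≤ (≤-pred (≰⇒> 1+n≰))

∃-max-size : ∀ {P : Subset n → Set} → (∀ T → Dec (P T)) → ∀ {T₀} → P T₀ →
  ∃[ T ] (P T × ∣ T₀ ∣ ≤ ∣ T ∣ × (∀ S → P S → ∣ S ∣ ≤ ∣ T ∣))
∃-max-size {n} {P} P? {T₀} pT₀ = climb n T₀ pT₀ (m≤m+n n ∣ T₀ ∣)
  where
  -- `d` bounds the number of vertices outside the current set, hence the number of further
  -- enlargements.
  climb : ∀ d T → P T → n ≤ d + ∣ T ∣ → ∃[ M ] (P M × ∣ T ∣ ≤ ∣ M ∣ × (∀ S → P S → ∣ S ∣ ≤ ∣ M ∣))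
  climb zero T p n≤ = T , p , ≤-refl , λ S _ → ≤-trans (∣p∣≤n S) n≤
  climb (suc d) T p n≤ with anySubset? (λ S → P? S ×-dec (∣ T ∣ <? ∣ S ∣))
  ... | no none = T , p , ≤-refl , λ S q → ≮⇒≥ λ T<S → none (S , q , T<S)
  ... | yes (S , q , T<S) =
    let M , r , S≤M , max = climb d S q (≤-trans n≤ (≤-trans (≤-reflexive (sym (+-suc d _))) (+-monoʳ-≤ d T<S)))
    in M , r , ≤-trans (<⇒≤ T<S) S≤M , max

-- A largest set is at least as large as the one built along the tree, which gives the factor 2;
-- fewer than 14ℓ vertices together with 2^ℓ ≤ n² give the exponent 28.
homogeneous-number : ∀ ℓ (G : Graph n) b → 2 ^ ℓ ≤ n ^ 2 →
  (∀ T → Homogeneous G b T → ∣ T ∣ < 14 * ℓ) → ∃[ T ] (Homogeneous G b T × n ≤ 4 ^ ∣ T ∣) →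
  ∃[ M ] (Homogeneous G b M × (∀ S → Homogeneous G b S → ∣ S ∣ ≤ ∣ M ∣)
    × n ^ 1 ≤ 2 ^ (2 * ∣ M ∣) × 2 ^ (1 * ∣ M ∣) ≤ n ^ 28)
homogeneous-number {n} ℓ G b ℓ≤ small (T , h , n≤) =
  let M , h′ , T≤M , max = ∃-max-size (homogeneous? G b) h in
  M , h′ , max ,
  (begin
    n ^ 1            ≡⟨ *-identityʳ n ⟩
    n                ≤⟨ n≤ ⟩
    4 ^ ∣ T ∣        ≤⟨ ^-monoʳ-≤ 4 T≤M ⟩
    (2 ^ 2) ^ ∣ M ∣  ≡⟨ ^-*-assoc 2 2 ∣ M ∣ ⟩
    2 ^ (2 * ∣ M ∣)  ∎) ,
  (begin
    2 ^ (1 * ∣ M ∣)  ≡⟨ cong (2 ^_) (*-identityˡ ∣ M ∣) ⟩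
    2 ^ ∣ M ∣        ≤⟨ ^-monoʳ-≤ 2 (<⇒≤ (small M h′)) ⟩
    2 ^ (14 * ℓ)     ≡⟨ cong (2 ^_) (*-comm 14 ℓ) ⟩
    2 ^ (ℓ * 14)     ≡⟨ ^-*-assoc 2 ℓ 14 ⟨
    (2 ^ ℓ) ^ 14     ≤⟨ ^-monoˡ-≤ 14 ℓ≤ ⟩
    (n ^ 2) ^ 14     ≡⟨ ^-*-assoc n 2 14 ⟩
    n ^ 28           ∎)
  where open ≤-Reasoning

-- Normal graphs with logarithmic clique and independence numbers

ramsey-normal : ∀ ℓ n → 1 ≤ ℓ → 1 ≤ n → n ≤ 2 ^ ℓ →
  Σ (Graph n) λ G → IsNormal G × (∀ b T → Homogeneous G b T → ∣ T ∣ < 14 * ℓ)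
    × (∀ b → ∃[ T ] (Homogeneous G b T × n ≤ 4 ^ ∣ T ∣))
ramsey-normal ℓ n 1≤ℓ 1≤n n≤ = G , normal s G ext , proj₂ completion , large s G ext
  where
  open ≤-Reasoning
  k : ℕ
  k = 14 * ℓ

  s : Scheme ℓ n
  s = scheme ℓ n 1≤n n≤

  wide : ∀ b T → ∣ T ∣ ≡ k → 2 + ℓ * k ≤ width (clause b (template s) T)
  wide b T eq = open-pairs-bound ℓ _ (fixedPairs (template s) T) (pairs T) 1≤ℓ (width-clause b (template s) T)
    (subst (λ t → fixedPairs (template s) T ≤ (3 + 2 * ℓ) * t) eq (sparse s T))
    (subst (λ t → pairs T + pairs T + t ≡ t * t) eq (pairs-square T))

  -- Of the summand 2 in the exponent, one unit pays for the two colours and one makes the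
  -- inequality strict.
  few : 2 * n ^ k < 2 ^ (2 + ℓ * k)
  few = begin-strict
    2 * n ^ k        ≤⟨ *-monoʳ-≤ 2 (^-monoˡ-≤ k n≤) ⟩
    2 * (2 ^ ℓ) ^ k  ≡⟨ cong (2 *_) (^-*-assoc 2 ℓ k) ⟩
    2 ^ (1 + ℓ * k)  <⟨ ^-monoʳ-< 2 ≤-refl (n<1+n (1 + ℓ * k)) ⟩
    2 ^ (2 + ℓ * k)  ∎

  completion : ∃[ x ] (∀ b T → Homogeneous (toGraph (complete (template s) x)) b T → ∣ T ∣ < k)
  completion = ramsey-completion k (2 + ℓ * k) (template s) wide few

  G : Graph n
  G = toGraph (complete (template s) (proj₁ completion))

  ext : Extends G (template s)
  ext = complete-extends (template s) (proj₁ completion)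

-- The constants are the rationals a = p / q and b = r / s, and each comparison with log₂ n is
-- exponentiated and cleared of denominators.
theorem3 : Σ ℕ λ p → Σ ℕ λ q → Σ ℕ λ r → Σ ℕ λ s →
    0 < p × 0 < q × 0 < s × p * s ≤ r * q ×
    (∀ n → 2 ≤ n →
    Σ (Graph n) λ G → IsNormal G ×
    (∃[ ω ] (IsCliqueNumber G ω × n ^ p ≤ 2 ^ (q * ω) × 2 ^ (s * ω) ≤ n ^ r)) ×
    (∃[ α ] (IsIndependenceNumber G α × n ^ p ≤ 2 ^ (q * α) × 2 ^ (s * α) ≤ n ^ r)))
-- Here a = 1/2 and b = 28.
theorem3 = 1 , 2 , 28 , 1 , s≤s z≤n , s≤s z≤n , s≤s z≤n , s≤s z≤n , λ n 2≤n →
  let ℓ , 1≤ℓ , n≤ , ≤n² = power-of-two-near n 2≤n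
      G , nrm , small , big = ramsey-normal ℓ n 1≤ℓ (<⇒≤ 2≤n) n≤
      C , clique , C-max , C-lower , C-upper = homogeneous-number ℓ G true ≤n² (small true) (big true)
      S , stable , S-max , S-lower , S-upper = homogeneous-number ℓ G false ≤n² (small false) (big false)
  in G , nrm ,
     (∣ C ∣ , ((C , clique , refl) , C-max) , C-lower , C-upper) ,
     (∣ S ∣ , ((S , homogeneous⇒stable G stable , refl) , λ T → S-max T ∘ stable⇒homogeneous G) , S-lower , S-upper)
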